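{- The category $\mathbf{CA}$ of conditional algebras with conditional homomorphisms and the category $\mathbf{CS}$ of conditional spaces with conditional functions are dually equivalent.
   Context: A conditional algebra is $\langle A,\to\rangle$ with $A$ a Boolean algebra and $\to$ binary with $a\to1=1$, $(a\to b)\wedge(a\to c)=a\to(b\wedge c)$, $(a\vee b)\to c\le(a\to c)\wedge(b\to c)$. A conditional homomorphism is a Boolean homomorphism $h$ with $h(a\to b)=h(a)\to h(b)$. A conditional space is $\langle X,\tau,T\rangle$ with $\langle X,\tau\rangle$ a Boolean space and $T\subseteq X\times\mathcal{C}(\tau)\times X$ ($\mathcal{C}(\tau)$ the closed sets) satisfying: (T1) $T(x,Y)=\{y:T(x,Y,y)\}$ is closed for every $x$ and closed $Y$; (T2) for clopen $U,V$, $U\to_T V=\{x:\text{for all closed }Z\subseteq U,\ T(x,Z)\subseteq V\}$ is clopen; (T3) for closed $Y$, $T(x,Y,y)$ iff $T(x,U,y)$ for all clopen $U\supseteq Y$. A conditional function between conditional spaces $\langle X_1,\tau_1,T_1\rangle$, $\langle X_2,\tau_2,T_2\rangle$ is a continuous $f\colon X_1\to X_2$ such that for all $x\in X_1$ and clopen $U,V\subseteq X_2$: $T_1(x,f^{ -1}[U])\subseteq f^{ -1}[V]$ iff $T_2(f(x),U)\subseteq V$. In both categories composition is composition of maps and identities are identity maps. -}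

module Defs where

open import Level using (Level; _⊔_; suc)
open import Function.Base using (id; _∘′_)
open import Function.Bundles using (_⇔_)
import Function.Construct.Identity as Identity
import Function.Construct.Composition as Composition
open import Data.List.Base using (List)
open import Data.List.Relation.Unary.Any using (Any)
open import Data.Product.Base using (Σ-syntax; ∃-syntax; _×_)
open import Relation.Binary.Bundles using (Poset)
open import Relation.Binary.Core using (Rel)
open import Relation.Binary.Structures using (IsEquivalence)
open import Relation.Binary.PropositionalEquality.Core using (_≡_; _≢_; refl; sym; trans; cong)
open import Relation.Unary using (Pred; _∈_; _⊆_; _≐_; Empty; ∁; _∩_; ⋃; _⊢_)
open import Relation.Unary.Polymorphic using (∅; U)
open import Algebra.Core using (Op₂)
open import Algebra.Lattice.Bundles using (BooleanAlgebra)
open import Algebra.Lattice.Morphism.Structures using (IsLatticeHomomorphism)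
import Algebra.Lattice.Morphism.Construct.Identity as LatticeIdentity
import Algebra.Lattice.Morphism.Construct.Composition as LatticeComposition
import Algebra.Lattice.Properties.Lattice as LatticeProperties

record Category (o h e : Level) : Set (suc (o ⊔ h ⊔ e)) where
  infix  4 _≈_
  infixr 9 _∘_
  field
    Obj           : Set o
    Hom           : Obj → Obj → Set h
    _≈_           : ∀ {A B} → Rel (Hom A B) e
    idₘ           : ∀ {A} → Hom A A
    _∘_           : ∀ {A B C} → Hom B C → Hom A B → Hom A C
    isEquivalence : ∀ {A B} → IsEquivalence (_≈_ {A} {B})
    ∘-cong        : ∀ {A B C} {f f′ : Hom B C} {g g′ : Hom A B} →
                    f ≈ f′ → g ≈ g′ → f ∘ g ≈ f′ ∘ g′
    identityˡ     : ∀ {A B} (f : Hom A B) → idₘ ∘ f ≈ f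
    identityʳ     : ∀ {A B} (f : Hom A B) → f ∘ idₘ ≈ f
    assoc         : ∀ {A B C D} (f : Hom C D) (g : Hom B C) (h : Hom A B) →
                    (f ∘ g) ∘ h ≈ f ∘ (g ∘ h)

op : ∀ {o h e} → Category o h e → Category o h e
op C = record
  { Obj           = Obj
  ; Hom           = λ A B → Hom B A
  ; _≈_           = _≈_
  ; idₘ           = idₘ
  ; _∘_           = λ f g → g ∘ f
  ; isEquivalence = isEquivalence
  ; ∘-cong        = λ p q → ∘-cong q p
  ; identityˡ     = identityʳ
  ; identityʳ     = identityˡ
  ; assoc         = λ f g h → IsEquivalence.sym isEquivalence (assoc h g f)
  } where open Category C

record Functor {o h e o′ h′ e′} (C : Category o h e) (D : Category o′ h′ e′)
       : Set (o ⊔ h ⊔ e ⊔ o′ ⊔ h′ ⊔ e′) where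
  private
    module C = Category C
    module D = Category D
  field
    F₀     : C.Obj → D.Obj
    F₁     : ∀ {A B} → C.Hom A B → D.Hom (F₀ A) (F₀ B)
    F-cong : ∀ {A B} {f g : C.Hom A B} → f C.≈ g → F₁ f D.≈ F₁ g
    F-id   : ∀ {A} → F₁ (C.idₘ {A}) D.≈ D.idₘ
    F-∘    : ∀ {A B E} (f : C.Hom B E) (g : C.Hom A B) →
             F₁ (f C.∘ g) D.≈ F₁ f D.∘ F₁ g

idF : ∀ {o h e} {C : Category o h e} → Functor C C
idF {C = C} = record
  { F₀     = id
  ; F₁     = id
  ; F-cong = id
  ; F-id   = IsEquivalence.refl isEquivalence
  ; F-∘    = λ _ _ → IsEquivalence.refl isEquivalence
  } where open Category C

infixr 9 _∘F_

_∘F_ : ∀ {o h e o′ h′ e′ o″ h″ e″}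
       {C : Category o h e} {D : Category o′ h′ e′} {E : Category o″ h″ e″} →
       Functor D E → Functor C D → Functor C E
_∘F_ {E = E} G F = record
  { F₀     = λ A → G.F₀ (F.F₀ A)
  ; F₁     = λ f → G.F₁ (F.F₁ f)
  ; F-cong = λ p → G.F-cong (F.F-cong p)
  ; F-id   = IsEquivalence.trans isEquivalence (G.F-cong F.F-id) G.F-id
  ; F-∘    = λ f g → IsEquivalence.trans isEquivalence
                       (G.F-cong (F.F-∘ f g)) (G.F-∘ (F.F₁ f) (F.F₁ g))
  }
  where
  open Category E
  module F = Functor F
  module G = Functor G

record NaturalIsomorphism {o h e o′ h′ e′}
       {C : Category o h e} {D : Category o′ h′ e′} (F G : Functor C D)
       : Set (o ⊔ h ⊔ e ⊔ o′ ⊔ h′ ⊔ e′) where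
  private
    module C = Category C
    module F = Functor F
    module G = Functor G
  open Category D
  field
    η        : ∀ A → Hom (F.F₀ A) (G.F₀ A)
    η⁻¹      : ∀ A → Hom (G.F₀ A) (F.F₀ A)
    natural  : ∀ {A B} (f : C.Hom A B) → η B ∘ F.F₁ f ≈ G.F₁ f ∘ η A
    inverseˡ : ∀ A → η⁻¹ A ∘ η A ≈ idₘ
    inverseʳ : ∀ A → η A ∘ η⁻¹ A ≈ idₘ

record Equivalent {o h e o′ h′ e′} (C : Category o h e) (D : Category o′ h′ e′)
       : Set (o ⊔ h ⊔ e ⊔ o′ ⊔ h′ ⊔ e′) where
  field
    F      : Functor C D
    G      : Functor D C
    unit   : NaturalIsomorphism idF (G ∘F F)
    counit : NaturalIsomorphism (F ∘F G) idF

DuallyEquivalent : ∀ {o h e o′ h′ e′} →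
                   Category o h e → Category o′ h′ e′ → Set (o ⊔ h ⊔ e ⊔ o′ ⊔ h′ ⊔ e′)
DuallyEquivalent C D = Equivalent (op C) D

record ConditionalAlgebra (ℓ : Level) : Set (suc ℓ) where
  infixr 5 _⇾_
  field
    booleanAlgebra : BooleanAlgebra ℓ ℓ

  open BooleanAlgebra booleanAlgebra public
  open Poset (LatticeProperties.poset lattice) public using (_≤_)

  field
    _⇾_     : Op₂ Carrier
    ⇾-cong  : ∀ {a a′ b b′} → a ≈ a′ → b ≈ b′ → (a ⇾ b) ≈ (a′ ⇾ b′)
    ⇾-⊤     : ∀ a → (a ⇾ ⊤) ≈ ⊤
    ⇾-∧     : ∀ a b c → ((a ⇾ b) ∧ (a ⇾ c)) ≈ (a ⇾ (b ∧ c))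
    ∨-⇾     : ∀ a b c → ((a ∨ b) ⇾ c) ≤ ((a ⇾ c) ∧ (b ⇾ c))

record ConditionalHomomorphism {ℓ} (A B : ConditionalAlgebra ℓ) : Set ℓ where
  private
    module A = ConditionalAlgebra A
    module B = ConditionalAlgebra B
  field
    ⟦_⟧                   : A.Carrier → B.Carrier
    isLatticeHomomorphism : IsLatticeHomomorphism A.rawLattice B.rawLattice ⟦_⟧
    ⊤-homo                : ⟦ A.⊤ ⟧ B.≈ B.⊤
    ⊥-homo                : ⟦ A.⊥ ⟧ B.≈ B.⊥
    ¬-homo                : ∀ a → ⟦ A.¬ a ⟧ B.≈ (B.¬ ⟦ a ⟧)
    ⇾-homo                : ∀ a b → ⟦ a A.⇾ b ⟧ B.≈ (⟦ a ⟧ B.⇾ ⟦ b ⟧)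

  open IsLatticeHomomorphism isLatticeHomomorphism public

CA : ∀ ℓ → Category (suc ℓ) ℓ ℓ
CA ℓ = record
  { Obj           = ConditionalAlgebra ℓ
  ; Hom           = ConditionalHomomorphism
  ; _≈_           = λ {A} {B} f g → ∀ a → ConditionalAlgebra._≈_ B (⟦ f ⟧ a) (⟦ g ⟧ a)
  ; idₘ           = λ {A} → idCA A
  ; _∘_           = compCA
  ; isEquivalence = λ {A} {B} → let open ConditionalAlgebra B in record
      { refl  = λ _ → IsEquivalence.refl isEquivalence
      ; sym   = λ p a → IsEquivalence.sym isEquivalence (p a)
      ; trans = λ p q a → IsEquivalence.trans isEquivalence (p a) (q a)
      }
  ; ∘-cong        = λ {A} {B} {C} {f} {f′} {g} {g′} p q a →
      IsEquivalence.trans (ConditionalAlgebra.isEquivalence C)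
        (⟦⟧-cong f (q a)) (p (⟦ g′ ⟧ a))
  ; identityˡ     = λ {A} {B} _ _ → IsEquivalence.refl (ConditionalAlgebra.isEquivalence B)
  ; identityʳ     = λ {A} {B} _ _ → IsEquivalence.refl (ConditionalAlgebra.isEquivalence B)
  ; assoc         = λ {A} {B} {C} {D} _ _ _ _ →
      IsEquivalence.refl (ConditionalAlgebra.isEquivalence D)
  }
  where
  open ConditionalHomomorphism

  idCA : (A : ConditionalAlgebra ℓ) → ConditionalHomomorphism A A
  idCA A = record
    { ⟦_⟧                   = id
    ; isLatticeHomomorphism = LatticeIdentity.isLatticeHomomorphism rawLattice ≈-refl
    ; ⊤-homo                = ≈-refl
    ; ⊥-homo                = ≈-refl
    ; ¬-homo                = λ _ → ≈-refl
    ; ⇾-homo                = λ _ _ → ≈-refl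
    }
    where
    open ConditionalAlgebra A
    ≈-refl : ∀ {a} → a ≈ a
    ≈-refl = IsEquivalence.refl isEquivalence

  compCA : {A B C : ConditionalAlgebra ℓ} →
           ConditionalHomomorphism B C → ConditionalHomomorphism A B →
           ConditionalHomomorphism A C
  compCA {C = C} f g = record
    { ⟦_⟧                   = ⟦ f ⟧ ∘′ ⟦ g ⟧
    ; isLatticeHomomorphism = LatticeComposition.isLatticeHomomorphism ≈-trans
                                (isLatticeHomomorphism g) (isLatticeHomomorphism f)
    ; ⊤-homo                = ≈-trans (⟦⟧-cong f (⊤-homo g)) (⊤-homo f)
    ; ⊥-homo                = ≈-trans (⟦⟧-cong f (⊥-homo g)) (⊥-homo f)
    ; ¬-homo                = λ a → ≈-trans (⟦⟧-cong f (¬-homo g a)) (¬-homo f (⟦ g ⟧ a))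
    ; ⇾-homo                = λ a b → ≈-trans (⟦⟧-cong f (⇾-homo g a b))
                                        (⇾-homo f (⟦ g ⟧ a) (⟦ g ⟧ b))
    }
    where
    open ConditionalAlgebra C using (_≈_; isEquivalence)
    ≈-trans : ∀ {a b c} → a ≈ b → b ≈ c → a ≈ c
    ≈-trans = IsEquivalence.trans isEquivalence

-- Points are compared with _≡_; subsets are predicates, compared with _≐_.
-- Classically every set of subsets of X : Set ℓ is, up to _≐_, a family
-- indexed by some I : Set ℓ (a subtype of X → Bool), so it is enough to take
-- unions and covers over such families.

record TopologicalSpace (ℓ : Level) : Set (suc ℓ) where
  field
    Point     : Set ℓ
    IsOpen    : Pred (Pred Point ℓ) ℓ
    open-resp : ∀ {P Q} → P ≐ Q → IsOpen P → IsOpen Q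
    open-∅    : IsOpen ∅
    open-U    : IsOpen U
    open-∩    : ∀ {P Q} → IsOpen P → IsOpen Q → IsOpen (P ∩ Q)
    open-⋃    : (I : Set ℓ) (P : I → Pred Point ℓ) → (∀ i → IsOpen (P i)) → IsOpen (⋃ I P)

  IsClosed : Pred (Pred Point ℓ) ℓ
  IsClosed P = IsOpen (∁ P)

  IsClopen : Pred (Pred Point ℓ) ℓ
  IsClopen P = IsOpen P × IsClosed P

  record ClosedSet : Set (suc ℓ) where
    constructor closedSet
    field
      set      : Pred Point ℓ
      isClosed : IsClosed set

  record ClopenSet : Set (suc ℓ) where
    constructor clopenSet
    field
      set      : Pred Point ℓ
      isOpen   : IsOpen set
      isClosed : IsClosed set

    closed : ClosedSet
    closed = closedSet set isClosed

  open ClosedSet public using () renaming (set to ⟪_⟫)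
  open ClopenSet public using (closed) renaming (set to ⟨_⟩)

  Compact : Set (suc ℓ)
  Compact = (I : Set ℓ) (P : I → Pred Point ℓ) → (∀ i → IsOpen (P i)) →
            (∀ x → x ∈ ⋃ I P) → Σ[ is ∈ List I ] (∀ x → Any (λ i → x ∈ P i) is)

  Hausdorff : Set (suc ℓ)
  Hausdorff = ∀ {x y} → x ≢ y →
              ∃[ P ] ∃[ Q ] IsOpen P × IsOpen Q × x ∈ P × y ∈ Q × Empty (P ∩ Q)

  ZeroDimensional : Set (suc ℓ)
  ZeroDimensional = ∀ {P x} → IsOpen P → x ∈ P → ∃[ Q ] IsClopen Q × x ∈ Q × Q ⊆ P

record BooleanSpace (ℓ : Level) : Set (suc ℓ) where
  field
    topologicalSpace : TopologicalSpace ℓ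

  open TopologicalSpace topologicalSpace public

  field
    compact         : Compact
    hausdorff       : Hausdorff
    zeroDimensional : ZeroDimensional

record ConditionalSpace (ℓ : Level) : Set (suc ℓ) where
  field
    booleanSpace : BooleanSpace ℓ

  open BooleanSpace booleanSpace public

  -- y ∈ T x Y encodes T(x,Y,y).  Invariance of T under _≐_ of the closed set
  -- (and under change of the proof of closedness) follows from T3.
  field
    T : Point → ClosedSet → Pred Point ℓ

  _⇾ₜ_ : ClopenSet → ClopenSet → Pred Point (suc ℓ)
  (C ⇾ₜ D) x = (Z : ClosedSet) → ⟪ Z ⟫ ⊆ ⟨ C ⟩ → T x Z ⊆ ⟨ D ⟩

  -- C ⇾ₜ D quantifies over all closed sets and so is a predicate one level
  -- above the subsets the topology speaks of; T2 says that it is clopen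
  -- by asking for a clopen set with the same elements.
  field
    T1 : ∀ x Y → IsClosed (T x Y)
    T2 : ∀ C D → Σ[ W ∈ ClopenSet ] ⟨ W ⟩ ≐ (C ⇾ₜ D)
    T3 : ∀ x Y y → y ∈ T x Y ⇔ (∀ C → ⟪ Y ⟫ ⊆ ⟨ C ⟩ → y ∈ T x (closed C))

record ConditionalFunction {ℓ} (X Y : ConditionalSpace ℓ) : Set (suc ℓ) where
  private
    module X = ConditionalSpace X
    module Y = ConditionalSpace Y
  field
    fun        : X.Point → Y.Point
    continuous : ∀ P → Y.IsOpen P → X.IsOpen (fun ⊢ P)

  preimage : Y.ClopenSet → X.ClopenSet
  preimage (TopologicalSpace.clopenSet P isOpen isClosed) =
    TopologicalSpace.clopenSet (fun ⊢ P) (continuous P isOpen) (continuous (∁ P) isClosed)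

  field
    conditional : ∀ x C D →
                  X.T x (X.closed (preimage C)) ⊆ X.⟨ preimage D ⟩ ⇔
                  Y.T (fun x) (Y.closed C) ⊆ Y.⟨ D ⟩

CS : ∀ ℓ → Category (suc ℓ) (suc ℓ) ℓ
CS ℓ = record
  { Obj           = ConditionalSpace ℓ
  ; Hom           = ConditionalFunction
  ; _≈_           = λ f g → ∀ x → fun f x ≡ fun g x
  ; idₘ           = idCS
  ; _∘_           = compCS
  ; isEquivalence = record
      { refl  = λ _ → refl
      ; sym   = λ p x → sym (p x)
      ; trans = λ p q x → trans (p x) (q x)
      }
  ; ∘-cong        = λ {_} {_} {_} {f} {_} {_} {g′} p q x →
      trans (cong (fun f) (q x)) (p (fun g′ x))
  ; identityˡ     = λ _ _ → refl
  ; identityʳ     = λ _ _ → refl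
  ; assoc         = λ _ _ _ _ → refl
  }
  where
  open ConditionalFunction

  idCS : {X : ConditionalSpace ℓ} → ConditionalFunction X X
  idCS = record
    { fun         = id
    ; continuous  = λ _ → id
    ; conditional = λ _ _ _ → Identity.⇔-id _
    }

  compCS : {X Y Z : ConditionalSpace ℓ} →
           ConditionalFunction Y Z → ConditionalFunction X Y → ConditionalFunction X Z
  compCS f g = record
    { fun         = fun f ∘′ fun g
    ; continuous  = λ P o → continuous g (fun f ⊢ P) (continuous f P o)
    ; conditional = λ x C D → Composition._⇔-∘_
        (conditional f (fun g x) C D) (conditional g x (preimage f C) (preimage f D))
    }

{-# OPTIONS --safe #-}
module Submission where

-- Stone duality lifted to the conditional structure.  The spectrum of a
-- conditional algebra carries T(u,Y,v) iff b ∈ v whenever Y ⊆ φ(a) and a ⇾ b ∈ u;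
-- the clopens of a conditional space carry ⇾ given by T2.  Both translations are
-- controlled by one equivalence, T(x,C) ⊆ D iff x ∈ C ⇾ D for clopen C and D.  For
-- the spectrum it says that a filter {b : a ⇾ b ∈ u} omitting d extends to an
-- ultrafilter omitting d; for a space it says that T(x,-) is monotone, by T3.
-- Hence the Stone maps φ and x ↦ {C : x ∈ C}, and the maps inverse to them,
-- respect the conditional structure.
--
-- Subsets are Bool-valued functions, so that ultrafilters, clopens and families
-- of subsets stay at level ℓ.

open import Algebra.Lattice.Bundles using (BooleanAlgebra)
import Algebra.Lattice.Properties.BooleanAlgebra as BooleanAlgebraProperties
open import Axiom.ExcludedMiddle using (ExcludedMiddle)
open import Axiom.Extensionality.Propositional using (Extensionality)
open import Data.Bool.Base as Bool using (Bool; true; false; not)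
import Data.Bool.Properties as Bool
open import Data.Empty using (⊥-elim)
open import Data.List.Base using (List; []; _∷_; _++_)
open import Data.List.Relation.Unary.Any as Any using (Any; here; there)
import Data.List.Relation.Unary.Any.Properties as Any
open import Data.Product.Base using (∃; ∃-syntax; _×_; _,_; proj₁; proj₂)
open import Data.Sum.Base using (_⊎_; inj₁; inj₂; [_,_]′)
open import Function.Base using (id; _∘′_)
open import Function.Bundles using (_⇔_; mk⇔; Equivalence)
open import Function.Construct.Composition using (_⇔-∘_)
open import Function.Construct.Identity using (⇔-id)
open import Function.Construct.Symmetry using (⇔-sym)
open import Level using (Level; _⊔_; Lift; lift; lower)
import Relation.Binary.Lattice as Order
open import Relation.Binary.PropositionalEquality.Core using (_≡_; _≢_; refl; sym; trans; cong; cong₂; subst)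
open import Relation.Binary.PropositionalEquality.Properties using (module ≡-Reasoning)
open import Relation.Nullary.Decidable using (Dec; yes; no; does; dec-true; decidable-stable; recompute)
open import Relation.Nullary.Negation using (¬_; contradiction)
open import Relation.Unary using (Pred; _∈_; _⊆_; _≐_; ∁; ⋃; _⊢_)
open import Defs using (CA; CS; DuallyEquivalent; op; Functor; NaturalIsomorphism; idF; _∘F_)
open import Defs using (TopologicalSpace; BooleanSpace)
open import Defs using (ConditionalAlgebra; ConditionalHomomorphism; ConditionalSpace; ConditionalFunction)

-- Truth values in `Bool`.

private
  module BoolProperties = BooleanAlgebraProperties Bool.∨-∧-booleanAlgebra

  variable
    a ℓ : Level

  does-true : {A : Set a} (d : Dec A) → does d ≡ true → A
  does-true (yes x) _ = x

  not-true⇒false : ∀ {x} → x ≢ true → x ≡ false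
  not-true⇒false = Bool.¬-not

  true≢false : ∀ {x} → x ≡ true → x ≢ false
  true≢false refl ()

  ∧-true : ∀ {x y} → x ≡ true → y ≡ true → x Bool.∧ y ≡ true
  ∧-true refl refl = refl

module Classical (em : ∀ {a} → ExcludedMiddle a) (ext : ∀ {a b} → Extensionality a b) where

  ⌊_⌋ : Set a → Bool
  ⌊ A ⌋ = does (em {P = A})

  ⌊⌋⁺ : {A : Set a} → A → ⌊ A ⌋ ≡ true
  ⌊⌋⁺ = dec-true em

  ⌊⌋⁻ : {A : Set a} → ⌊ A ⌋ ≡ true → A
  ⌊⌋⁻ = does-true em

  dne : {A : Set a} → ¬ ¬ A → A
  dne = decidable-stable em

  -- Zorn's lemma for set systems

  module _ {A : Set a} where

    Subset : Set a
    Subset = A → Bool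

    infix 4 _⊑_

    _⊑_ : Subset → Subset → Set a
    S ⊑ S′ = ∀ x → S x ≡ true → S′ x ≡ true

    ⊑-trans : ∀ {S S′ S″} → S ⊑ S′ → S′ ⊑ S″ → S ⊑ S″
    ⊑-trans p q x = q x ∘′ p x

    ⊑-antisym : ∀ {S S′} → S ⊑ S′ → S′ ⊑ S → S ≡ S′
    ⊑-antisym p q = ext λ x → Bool.⇔→≡ (mk⇔ (p x) (q x))

    union : (Subset → Bool) → Subset
    union K x = ⌊ ∃[ S ] K S ≡ true × S x ≡ true ⌋

    ⊑-union : ∀ K {S} → K S ≡ true → S ⊑ union K
    ⊑-union K S∈K x x∈S = ⌊⌋⁺ (_ , S∈K , x∈S)

    union-least : ∀ K {S} → (∀ S′ → K S′ ≡ true → S′ ⊑ S) → union K ⊑ S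
    union-least K p x x∈ = let S′ , S′∈K , x∈S′ = ⌊⌋⁻ x∈ in p S′ S′∈K x x∈S′

    IsChain : (Subset → Bool) → Set a
    IsChain K = ∀ {S S′} → K S ≡ true → K S′ ≡ true → S ⊑ S′ ⊎ S′ ⊑ S

    module _ {q} (Q : Pred Subset q)
             (Q-union : ∀ K → ∃[ S ] K S ≡ true → (∀ S → K S ≡ true → Q S) →
                        IsChain K → Q (union K))
             (S₀ : Subset) (Q-S₀ : Q S₀) where

      private
        Extension : Subset → Set (a ⊔ q)
        Extension S = ∃[ S′ ] Q S′ × S ⊑ S′ × ¬ S′ ⊑ S

        extend : (S : Subset) → Dec (Extension S) → Subset
        extend S (yes (S′ , _)) = S′
        extend S (no _)         = S

        -- `em` is a function returning a witness whenever `Extension S` holds, so it doubles as the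
        -- choice function that picks a proper extension.
        next : Subset → Subset
        next S = extend S em

        next-inflationary : ∀ S → S ⊑ next S
        next-inflationary S = helper em
          where
          helper : (d : Dec (Extension S)) → S ⊑ extend S d
          helper (yes (_ , _ , S⊑S′ , _)) = S⊑S′
          helper (no _)                   = λ _ → id

        next-Q : ∀ {S} → Q S → Q (next S)
        next-Q {S} QS = helper em
          where
          helper : (d : Dec (Extension S)) → Q (extend S d)
          helper (yes (_ , QS′ , _)) = QS′
          helper (no _)              = QS

        -- The least family containing S₀ and closed under next and unions;
        -- as in the Bourbaki–Witt theorem it turns out to be a chain.
        data Tower : Subset → Set a where
          base  : Tower S₀
          step  : ∀ {S} → Tower S → Tower (next S)
          limit : ∀ K → ∃[ S ] K S ≡ true → (∀ S → K S ≡ true → Tower S) → Tower (union K)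

        S₀-least : ∀ {S} → Tower S → S₀ ⊑ S
        S₀-least base                        = λ _ → id
        S₀-least (step {S} t)                = ⊑-trans (S₀-least t) (next-inflationary S)
        S₀-least (limit K (S , S∈K) towers) = ⊑-trans (S₀-least (towers S S∈K)) (⊑-union K S∈K)

        Extreme : Subset → Set a
        Extreme S = ∀ {S′} → Tower S′ → S′ ⊑ S → ¬ S ⊑ S′ → next S′ ⊑ S

        -- Induction on the second member. In the successor case, an `S′` strictly below `S` is
        -- settled by extremality; an `S′` that is not strictly below equals `S`. For a union,
        -- either some member contains `next S` or all lie below `S`.
        compare : ∀ {S S′} → Tower S → Extreme S → Tower S′ → S′ ⊑ S ⊎ next S ⊑ S′
        compare tS e base = inj₁ (S₀-least tS)
        compare {S} tS e (step {S′} t) with compare tS e t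
        ... | inj₂ p = inj₂ (⊑-trans p (next-inflationary S′))
        ... | inj₁ p with em {P = S ⊑ S′}
        ...   | no q  = inj₁ (e t p q)
        ...   | yes q = inj₂ (subst (λ R → next S ⊑ next R) (⊑-antisym q p) λ _ → id)
        compare {S} tS e (limit K _ towers) with em {P = ∃[ S′ ] K S′ ≡ true × next S ⊑ S′}
        ... | yes (S′ , S′∈K , p) = inj₂ (⊑-trans p (⊑-union K S′∈K))
        ... | no none = inj₁ (union-least K λ S′ S′∈K →
                [ id , (λ p → contradiction (S′ , S′∈K , p) none) ]′
                  (compare tS e (towers S′ S′∈K)))

        extreme : ∀ {S} → Tower S → Extreme S
        extreme base t p q = contradiction (S₀-least t) q
        extreme (step {S} tS) {S′} t p q with compare tS (extreme tS) t
        ... | inj₂ r = contradiction r q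
        ... | inj₁ r with em {P = S ⊑ S′}
        ...   | no s  = ⊑-trans (extreme tS t r s) (next-inflationary S)
        ...   | yes s = subst (λ R → next R ⊑ next S) (⊑-antisym s r) λ _ → id
        extreme (limit K ne towers) {S′} t p q
          with em {P = ∃[ S ] K S ≡ true × ¬ next S ⊑ S′}
        -- If every `next S` lay inside `S′`, so would the union. Hence some member has `next S`
        -- outside `S′`, and `compare` puts `S′` below that member.
        ... | no none = contradiction
                (union-least K λ S S∈K → ⊑-trans (next-inflationary S)
                  (dne λ r → none (S , S∈K , r))) q
        ... | yes (S , S∈K , r) with compare (towers S S∈K) (extreme (towers S S∈K)) t
        ...   | inj₂ s = contradiction s r
        ...   | inj₁ s with em {P = S ⊑ S′}
        ...     | no u = ⊑-trans (extreme (towers S S∈K) t s u) (⊑-union K S∈K)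
        -- Now `S′` is this member itself, hence extreme, and can be compared with the whole union.
        ...     | yes u with refl ← ⊑-antisym u s =
                  [ (λ v → contradiction v q) , id ]′
                    (compare t (extreme (towers S S∈K)) (limit K ne towers))

        Tower-chain : ∀ {S S′} → Tower S → Tower S′ → S ⊑ S′ ⊎ S′ ⊑ S
        Tower-chain {S} t t′ with compare t (extreme t) t′
        ... | inj₁ p = inj₂ p
        ... | inj₂ p = inj₁ (⊑-trans (next-inflationary S) p)

        Tower-Q : ∀ {S} → Tower S → Q S
        Tower-Q base                = Q-S₀
        Tower-Q (step t)            = next-Q (Tower-Q t)
        Tower-Q (limit K ne towers) = Q-union K ne (λ S S∈K → Tower-Q (towers S S∈K))
          λ p q → Tower-chain (towers _ p) (towers _ q)

        -- The whole tower as a family, so that `limit` puts its union back into the tower, where it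
        -- absorbs its own successor.
        family : Subset → Bool
        family S = ⌊ Tower S ⌋

        top : Subset
        top = union family

        top-Tower : Tower top
        top-Tower = limit family (S₀ , ⌊⌋⁺ base) λ _ → ⌊⌋⁻

        next-top⊑top : next top ⊑ top
        next-top⊑top = ⊑-union family (⌊⌋⁺ (step top-Tower))

      -- A proper extension of `top` within `Q` would make `next top` a proper extension too,
      -- against `next-top⊑top`.
      zorn : ∃[ M ] Q M × S₀ ⊑ M × (∀ S → Q S → M ⊑ S → S ⊑ M)
      zorn = top , Tower-Q top-Tower , S₀-least top-Tower , λ S QS top⊑S →
        dne λ S⋢top → helper S QS top⊑S S⋢top em next-top⊑top
        where
        helper : ∀ S → Q S → top ⊑ S → ¬ S ⊑ top →
                 (d : Dec (Extension top)) → ¬ extend top d ⊑ top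
        helper _ _  _ _ (yes (_ , _ , _ , p)) = p
        helper S QS p q (no none)             = λ _ → none (S , QS , p , q)

  -- Ultrafilters

  module Ultrafilters {c ℓ} (B : BooleanAlgebra c ℓ) where
    open BooleanAlgebra B renaming (¬_ to −_; refl to ≈-refl; sym to ≈-sym; trans to ≈-trans)
    open BooleanAlgebraProperties B
    open Order.Lattice ∨-∧-orderTheoreticLattice
      using (_≤_; x∧y≤x; x∧y≤y; ∧-greatest; ∨-least)
      renaming (refl to ≤-refl; trans to ≤-trans; reflexive to ≤-reflexive; antisym to ≤-antisym)

    record IsFilter (S : Carrier → Bool) : Set (c ⊔ ℓ) where
      field
        ⊤∈       : S ⊤ ≡ true
        ∧-closed : ∀ {x y} → S x ≡ true → S y ≡ true → S (x ∧ y) ≡ true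
        upward   : ∀ {x y} → x ≤ y → S x ≡ true → S y ≡ true

    record IsUltrafilter (χ : Carrier → Bool) : Set (c ⊔ ℓ) where
      field
        χ-cong : ∀ {x y} → x ≈ y → χ x ≡ χ y
        χ-∧    : ∀ x y → χ (x ∧ y) ≡ χ x Bool.∧ χ y
        χ-¬    : ∀ x → χ (− x) ≡ not (χ x)

    -- The proof component is irrelevant so that an ultrafilter is determined,
    -- up to _≡_, by its characteristic function.
    record Ultrafilter : Set (c ⊔ ℓ) where
      constructor ultrafilter
      field
        χ              : Carrier → Bool
        .isUltrafilter : IsUltrafilter χ

    open Ultrafilter public using (χ)

    -- Equality in `Bool` is decidable, so `recompute` recovers the equation from the irrelevant
    -- field.
    χ-cong : ∀ u {x y} → x ≈ y → χ u x ≡ χ u y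
    χ-cong (ultrafilter _ i) p = recompute (_ Bool.≟ _) (IsUltrafilter.χ-cong i p)

    χ-∧ : ∀ u x y → χ u (x ∧ y) ≡ χ u x Bool.∧ χ u y
    χ-∧ (ultrafilter _ i) x y = recompute (_ Bool.≟ _) (IsUltrafilter.χ-∧ i x y)

    χ-¬ : ∀ u x → χ u (− x) ≡ not (χ u x)
    χ-¬ (ultrafilter _ i) x = recompute (_ Bool.≟ _) (IsUltrafilter.χ-¬ i x)

    χ-∨ : ∀ u x y → χ u (x ∨ y) ≡ χ u x Bool.∨ χ u y
    χ-∨ u x y = begin
      χ u (x ∨ y)                          ≡⟨ χ-cong u (¬-involutive (x ∨ y)) ⟨
      χ u (− (− (x ∨ y)))                  ≡⟨ χ-cong u (¬-cong (deMorgan₂ x y)) ⟩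
      χ u (− (− x ∧ − y))                  ≡⟨ χ-¬ u _ ⟩
      not (χ u (− x ∧ − y))                ≡⟨ cong not (χ-∧ u _ _) ⟩
      not (χ u (− x) Bool.∧ χ u (− y))     ≡⟨ cong₂ (λ p q → not (p Bool.∧ q)) (χ-¬ u x) (χ-¬ u y) ⟩
      not (not (χ u x) Bool.∧ not (χ u y)) ≡⟨ not-∧-not (χ u x) (χ u y) ⟩
      χ u x Bool.∨ χ u y                   ∎
      where
      open ≡-Reasoning
      not-∧-not : ∀ p q → not (not p Bool.∧ not q) ≡ p Bool.∨ q
      not-∧-not true  _ = refl
      not-∧-not false q = Bool.not-involutive q

    χ-⊥ : ∀ u → χ u ⊥ ≡ false
    χ-⊥ u = begin
      χ u ⊥                        ≡⟨ χ-cong u (∧-complementʳ ⊥) ⟨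
      χ u (⊥ ∧ − ⊥)                ≡⟨ χ-∧ u ⊥ (− ⊥) ⟩
      χ u ⊥ Bool.∧ χ u (− ⊥)       ≡⟨ cong (χ u ⊥ Bool.∧_) (χ-¬ u ⊥) ⟩
      χ u ⊥ Bool.∧ not (χ u ⊥)     ≡⟨ Bool.∧-inverseʳ (χ u ⊥) ⟩
      false                        ∎
      where open ≡-Reasoning

    χ-⊤ : ∀ u → χ u ⊤ ≡ true
    χ-⊤ u = trans (χ-cong u (≈-sym ¬⊥≈⊤)) (trans (χ-¬ u ⊥) (cong not (χ-⊥ u)))

    χ-mono : ∀ u {x y} → x ≤ y → χ u x ≡ true → χ u y ≡ true
    -- `x ≤ y` unfolds to `x ≈ x ∧ y`.
    χ-mono u {x} {y} x≤y p = Bool.∧-conicalʳ (χ u x) (χ u y)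
      (trans (sym (χ-∧ u x y)) (trans (sym (χ-cong u x≤y)) p))

    ultrafilter-≡ : ∀ {u v} → (∀ x → χ u x ≡ χ v x) → u ≡ v
    ultrafilter-≡ {ultrafilter _ _} {ultrafilter _ _} p with refl ← ext p = refl

    -- Filters and the ultrafilter theorem.

    principal : ∀ b → IsFilter (λ x → ⌊ b ≤ x ⌋)
    principal b = record
      { ⊤∈       = ⌊⌋⁺ (≈-sym (∧-identityʳ b))
      ; ∧-closed = λ p q → ⌊⌋⁺ (∧-greatest (⌊⌋⁻ p) (⌊⌋⁻ q))
      ; upward   = λ x≤y p → ⌊⌋⁺ (≤-trans (⌊⌋⁻ p) x≤y)
      }

    -- For a filter `S`, the filter generated by `S` and `b`.
    adjoin : (Carrier → Bool) → Carrier → Carrier → Bool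
    adjoin S b x = ⌊ ∃[ m ] S m ≡ true × m ∧ b ≤ x ⌋

    module _ {S : Carrier → Bool} (F : IsFilter S) where
      open IsFilter F

      adjoin-isFilter : ∀ b → IsFilter (adjoin S b)
      adjoin-isFilter b = record
        { ⊤∈       = ⌊⌋⁺ (⊤ , ⊤∈ , ≈-sym (∧-identityʳ _))
        ; ∧-closed = λ p q → let m , m∈S , m∧b≤x = ⌊⌋⁻ p
                                 n , n∈S , n∧b≤y = ⌊⌋⁻ q in
            ⌊⌋⁺ (m ∧ n , ∧-closed m∈S n∈S , ∧-greatest
              (≤-trans (∧-greatest (≤-trans (x∧y≤x _ _) (x∧y≤x _ _)) (x∧y≤y _ _)) m∧b≤x)
              (≤-trans (∧-greatest (≤-trans (x∧y≤x _ _) (x∧y≤y _ _)) (x∧y≤y _ _)) n∧b≤y))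
        ; upward   = λ x≤y p → let m , m∈S , m∧b≤x = ⌊⌋⁻ p in
            ⌊⌋⁺ (m , m∈S , ≤-trans m∧b≤x x≤y)
        }

      ⊑-adjoin : ∀ b → S ⊑ adjoin S b
      ⊑-adjoin b x x∈S = ⌊⌋⁺ (x , x∈S , x∧y≤x _ _)

      ∈-adjoin : ∀ b → adjoin S b b ≡ true
      ∈-adjoin b = ⌊⌋⁺ (⊤ , ⊤∈ , x∧y≤y _ _)

      -- With `m ∧ b` and `n ∧ − b` both below `x`, splitting `m ∧ n` along `b ∨ − b` puts it below
      -- `x` as well.
      adjoin-cases : ∀ b x → adjoin S b x ≡ true → adjoin S (− b) x ≡ true → S x ≡ true
      adjoin-cases b x p q =
        let m , m∈S , m∧b≤x = ⌊⌋⁻ p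
            n , n∈S , n∧b≤x = ⌊⌋⁻ q
            mn = m ∧ n
        in upward
          (≤-trans (≤-reflexive (≈-trans (≈-sym (∧-identityʳ mn))
             (≈-trans (∧-congˡ (≈-sym (∨-complementʳ b))) (∧-distribˡ-∨ mn b (− b)))))
           (∨-least
             (≤-trans (∧-greatest (≤-trans (x∧y≤x _ _) (x∧y≤x _ _)) (x∧y≤y _ _)) m∧b≤x)
             (≤-trans (∧-greatest (≤-trans (x∧y≤x _ _) (x∧y≤y _ _)) (x∧y≤y _ _)) n∧b≤x)))
          (∧-closed m∈S n∈S)

    FilterAvoiding : Carrier → Pred (Carrier → Bool) (c ⊔ ℓ)
    FilterAvoiding b S = IsFilter S × S b ≡ false

    FilterAvoiding-union : ∀ b K → ∃[ S ] K S ≡ true → (∀ S → K S ≡ true → FilterAvoiding b S) →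
                           IsChain K → FilterAvoiding b (union K)
    FilterAvoiding-union b K (S₁ , S₁∈K) avoiding chain = record
      { ⊤∈       = ⊑-union K S₁∈K ⊤ (IsFilter.⊤∈ (proj₁ (avoiding S₁ S₁∈K)))
      ; ∧-closed = ∧-closed
      ; upward   = λ x≤y p → let S , S∈K , x∈S = ⌊⌋⁻ p in
          ⌊⌋⁺ (S , S∈K , IsFilter.upward (proj₁ (avoiding S S∈K)) x≤y x∈S)
      } , not-true⇒false λ p → let S , S∈K , b∈S = ⌊⌋⁻ p in
          true≢false b∈S (proj₂ (avoiding S S∈K))
      where
      ∧-closed : ∀ {x y} → union K x ≡ true → union K y ≡ true → union K (x ∧ y) ≡ true
      ∧-closed {x} {y} p q with ⌊⌋⁻ p | ⌊⌋⁻ q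
      ... | S , S∈K , x∈S | S′ , S′∈K , y∈S′ with chain S∈K S′∈K
      ...   | inj₁ S⊑S′ = ⌊⌋⁺ (S′ , S′∈K ,
                IsFilter.∧-closed (proj₁ (avoiding S′ S′∈K)) (S⊑S′ x x∈S) y∈S′)
      ...   | inj₂ S′⊑S = ⌊⌋⁺ (S , S∈K ,
                IsFilter.∧-closed (proj₁ (avoiding S S∈K)) x∈S (S′⊑S y y∈S′))

    -- Were `x` and `− x` both outside `M`, maximality would force `b` into both adjoined filters,
    -- hence into `M` by `adjoin-cases`. Were both inside, `⊥ ≤ b` would put `b` in `M`.
    maximal⇒ultrafilter : ∀ {b M} → FilterAvoiding b M →
                          (∀ S → FilterAvoiding b S → M ⊑ S → S ⊑ M) → IsUltrafilter M
    maximal⇒ultrafilter {b} {M} (F , b∉M) maximal = record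
      { χ-cong = λ x≈y → Bool.⇔→≡ (mk⇔ (upward (≤-reflexive x≈y)) (upward (≤-reflexive (≈-sym x≈y))))
      ; χ-∧    = λ x y → Bool.⇔→≡ (mk⇔
          (λ p → ∧-true (upward (x∧y≤x x y) p) (upward (x∧y≤y x y) p))
          (λ p → ∧-closed (Bool.∧-conicalˡ (M x) (M y) p) (Bool.∧-conicalʳ (M x) (M y) p)))
      ; χ-¬    = M-¬
      }
      where
      open IsFilter F

      M-¬ : ∀ x → M (− x) ≡ not (M x)
      M-¬ x with M x in eq | M (− x) in eq′
      ... | true  | false = refl
      ... | false | true  = refl
      ... | true  | true  = contradiction b∉M (true≢false
              (upward (≤-trans (≤-reflexive (∧-complementʳ x)) (≈-sym (∧-zeroˡ b)))
                (∧-closed eq eq′)))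
      ... | false | false = contradiction b∉M (true≢false
              (adjoin-cases F x b (forced x eq) (forced (− x) eq′)))
        where
        forced : ∀ y → M y ≡ false → adjoin M y b ≡ true
        forced y y∉M = Bool.¬-not λ b∉ → true≢false
          (maximal (adjoin M y) (adjoin-isFilter F y , b∉) (⊑-adjoin F y) y (∈-adjoin F y)) y∉M

    ultrafilter-theorem : ∀ {S b} → IsFilter S → S b ≡ false → ∃[ u ] S ⊑ χ u × χ u b ≡ false
    ultrafilter-theorem {S} {b} F b∉S =
      let M , avoiding , S⊑M , maximal =
            zorn (FilterAvoiding b) (FilterAvoiding-union b) S (F , b∉S)
      in ultrafilter M (maximal⇒ultrafilter avoiding maximal) , S⊑M , proj₂ avoiding

    -- If `x ≤ y` fails, the principal filter of `x` omits `y`, and so does some ultrafilter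
    -- extending it.
    separation : ∀ {x y} → (∀ u → χ u x ≡ true → χ u y ≡ true) → x ≤ y
    separation {x} {y} p = dne λ x≰y →
      let u , ⊑u , y∉u = ultrafilter-theorem (principal x) (not-true⇒false (x≰y ∘′ ⌊⌋⁻))
      in true≢false (p u (⊑u x (⌊⌋⁺ ≤-refl))) y∉u

    separation-≈ : ∀ {x y} → (∀ u → χ u x ≡ χ u y) → x ≈ y
    separation-≈ p = ≤-antisym (separation λ u → trans (sym (p u))) (separation λ u → trans (p u))

  -- `Lift` raises an equation in `Bool` to level `ℓ`, where the topology takes its subsets.
  ⌈_⌉ : {A : Set ℓ} → (A → Bool) → Pred A ℓ
  ⌈ S ⌉ x = Lift _ (S x ≡ true)

  -- Stone spaces

  module Stone {ℓ} (B : BooleanAlgebra ℓ ℓ) where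
    open BooleanAlgebra B using (Carrier; _∧_; _∨_; ⊤; ⊥) renaming (¬_ to −_)
    open Ultrafilters B public

    φ : Carrier → Pred Ultrafilter ℓ
    φ a = ⌈ (λ u → χ u a) ⌉

    χ-¬-false : ∀ u {a} → χ u a ≡ false → χ u (− a) ≡ true
    χ-¬-false u {a} p = trans (χ-¬ u a) (cong not p)

    χ-¬-true : ∀ u {a} → χ u a ≡ true → χ u (− a) ≡ false
    χ-¬-true u {a} p = trans (χ-¬ u a) (cong not p)

    χ-¬⁻ : ∀ u {a} → χ u (− a) ≡ false → χ u a ≡ true
    χ-¬⁻ u p = Bool.¬-not λ q → true≢false (χ-¬-false u q) p

    topologicalSpace : TopologicalSpace ℓ
    topologicalSpace = record
      { Point     = Ultrafilter
      -- The topology with the sets `φ a` as basis.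
      ; IsOpen    = λ P → ∀ u → P u → ∃[ a ] χ u a ≡ true × (∀ v → χ v a ≡ true → P v)
      ; open-resp = λ P≐Q o u u∈Q → let a , u∈a , a⊆P = o u (proj₂ P≐Q u∈Q) in
          a , u∈a , λ v v∈a → proj₁ P≐Q (a⊆P v v∈a)
      ; open-∅    = λ _ ()
      ; open-U    = λ u _ → ⊤ , χ-⊤ u , λ _ _ → _
      ; open-∩    = λ o o′ u (u∈P , u∈Q) →
          let a , u∈a , a⊆P = o u u∈P
              b , u∈b , b⊆Q = o′ u u∈Q
          in a ∧ b , trans (χ-∧ u a b) (∧-true u∈a u∈b) , λ v v∈ →
             let v∈′ = trans (sym (χ-∧ v a b)) v∈ in
             a⊆P v (Bool.∧-conicalˡ _ _ v∈′) , b⊆Q v (Bool.∧-conicalʳ (χ v a) _ v∈′)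
      ; open-⋃    = λ I P o u (i , u∈P) → let a , u∈a , a⊆P = o i u u∈P in
          a , u∈a , λ v v∈a → i , a⊆P v v∈a
      }

    open TopologicalSpace topologicalSpace
      using (IsOpen; ClopenSet; clopenSet; ⟨_⟩; Compact; Hausdorff; ZeroDimensional)

    φ-open : ∀ a → IsOpen (φ a)
    φ-open a u (lift u∈a) = a , u∈a , λ _ → lift

    φ-closed : ∀ a → IsOpen (∁ (φ a))
    φ-closed a u u∉a = − a , χ-¬-false u (not-true⇒false (u∉a ∘′ lift)) ,
      λ v v∈-a (lift v∈a) → true≢false v∈-a (χ-¬-true v v∈a)

    φ-clopen : Carrier → ClopenSet
    φ-clopen a = clopenSet (φ a) (φ-open a) (φ-closed a)

    compact : Compact
    -- No ultrafilter contains `⊥`, so this asks for a finite cover of the whole space, phrased as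
    -- membership of `⊥` in `S`.
    compact I P P-open covers with em {P = ∃[ is ] ∀ v → χ v ⊥ ≡ false → Any (λ i → P i v) is}
    ... | yes (is , p) = is , λ v → p v (χ-⊥ v)
    ... | no none =
      let u , S⊑u , _    = ultrafilter-theorem S-filter (not-true⇒false (none ∘′ ⌊⌋⁻))
          i , u∈Pi       = covers u
          a , u∈a , a⊆Pi = P-open i u u∈Pi
          -- Ultrafilters omitting `− a` contain `a`, so `P i` alone covers them and `− a` falls
          -- into `S`.
          u∈-a           = S⊑u (− a) (⌊⌋⁺ (i ∷ [] , λ v v∉-a → here (a⊆Pi v (χ-¬⁻ v v∉-a))))
      in contradiction (χ-¬-true u u∈a) (true≢false u∈-a)
      where
      -- If no finite subfamily covers, this is a proper filter, and an ultrafilter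
      -- extending it belongs to no P i.
      S : Carrier → Bool
      S x = ⌊ (∃[ is ] ∀ v → χ v x ≡ false → Any (λ i → P i v) is) ⌋

      S-∧ : ∀ {x y} → S x ≡ true → S y ≡ true → S (x ∧ y) ≡ true
      S-∧ {x} {y} p q with ⌊⌋⁻ p | ⌊⌋⁻ q
      ... | is , is-covers | js , js-covers = ⌊⌋⁺ (is ++ js , covers′)
        where
        covers′ : ∀ v → χ v (x ∧ y) ≡ false → Any (λ i → P i v) (is ++ js)
        covers′ v r with χ v x in eq
        ... | false = Any.++⁺ˡ (is-covers v eq)
        ... | true  = Any.++⁺ʳ is
                (js-covers v (trans (sym (trans (χ-∧ v x y) (cong (Bool._∧ χ v y) eq))) r))

      S-filter : IsFilter S
      S-filter = record
        { ⊤∈       = ⌊⌋⁺ ([] , λ v p → contradiction p (true≢false (χ-⊤ v)))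
        ; ∧-closed = S-∧
        ; upward   = λ x≤y p → let is , is-covers = ⌊⌋⁻ p in
            ⌊⌋⁺ (is , λ v y∉v → is-covers v
              (not-true⇒false λ x∈v → true≢false (χ-mono v x≤y x∈v) y∉v))
        }

    hausdorff : Hausdorff
    hausdorff {u} {v} u≢v with em {P = ∃[ a ] χ u a ≢ χ v a}
    ... | no none = contradiction (ultrafilter-≡ λ a → dne λ p → none (a , p)) u≢v
    ... | yes (a , p) with χ u a in eq | χ v a in eq′
    ...   | true  | true  = contradiction refl p
    ...   | false | false = contradiction refl p
    ...   | true  | false = φ a , φ (− a) , φ-open a , φ-open (− a) , lift eq ,
              lift (χ-¬-false v eq′) ,
              λ w (lift w∈a , lift w∈-a) → true≢false w∈-a (χ-¬-true w w∈a)
    ...   | false | true  = φ (− a) , φ a , φ-open (− a) , φ-open a , lift (χ-¬-false u eq) ,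
              lift eq′ ,
              λ w (lift w∈-a , lift w∈a) → true≢false w∈-a (χ-¬-true w w∈a)

    zeroDimensional : ZeroDimensional
    zeroDimensional P-open u∈P = let a , u∈a , a⊆P = P-open _ u∈P in
      φ a , (φ-open a , φ-closed a) , lift u∈a , λ {v} (lift v∈a) → a⊆P v v∈a

    booleanSpace : BooleanSpace ℓ
    booleanSpace = record
      { topologicalSpace = topologicalSpace
      ; compact          = compact
      ; hausdorff        = hausdorff
      ; zeroDimensional  = zeroDimensional
      }

    -- The basic sets inside `P` or inside its complement cover the space. In a finite subcover, the
    -- join of the elements of the first kind represents `P`.
    clopen-representation : ∀ C → ∃[ a ] ⟨ C ⟩ ≐ φ a
    clopen-representation (clopenSet P P-open P-closed) =
      let is , is-covers = compact I (φ ∘′ proj₁) (λ i → φ-open (proj₁ i)) covers in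
      join is ,
      (λ {u} u∈P → lift (⊆join is u u∈P (is-covers u))) ,
      (λ {u} (lift u∈) → join⊆ is u u∈)
      where
      I : Set ℓ
      I = ∃[ a ] ((∀ v → χ v a ≡ true → v ∈ P) ⊎ (∀ v → χ v a ≡ true → v ∈ ∁ P))

      covers : ∀ u → u ∈ ⋃ I (φ ∘′ proj₁)
      covers u with em {P = u ∈ P}
      ... | yes u∈P = let a , u∈a , a⊆P = P-open u u∈P in (a , inj₁ a⊆P) , lift u∈a
      ... | no u∉P  = let a , u∈a , a⊆P = P-closed u u∉P in (a , inj₂ a⊆P) , lift u∈a

      join : List I → Carrier
      join []                  = ⊥
      join ((a , inj₁ _) ∷ is) = a ∨ join is
      join ((_ , inj₂ _) ∷ is) = join is

      ⊆join : ∀ is u → u ∈ P → Any (λ i → u ∈ φ (proj₁ i)) is → χ u (join is) ≡ true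
      ⊆join ((a , inj₁ _)   ∷ is) u u∈P (here (lift u∈a)) =
        trans (χ-∨ u a (join is)) (cong (Bool._∨ χ u (join is)) u∈a)
      ⊆join ((a , inj₁ _)   ∷ is) u u∈P (there p) =
        trans (χ-∨ u a (join is)) (trans (cong (χ u a Bool.∨_) (⊆join is u u∈P p)) (Bool.∨-zeroʳ _))
      ⊆join ((a , inj₂ a⊆∁P) ∷ is) u u∈P (here (lift u∈a)) = contradiction u∈P (a⊆∁P u u∈a)
      ⊆join ((a , inj₂ _)   ∷ is) u u∈P (there p) = ⊆join is u u∈P p

      join⊆ : ∀ is u → χ u (join is) ≡ true → u ∈ P
      join⊆ []                    u p = contradiction (χ-⊥ u) (true≢false p)
      join⊆ ((_ , inj₂ _)   ∷ is) u p = join⊆ is u p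
      join⊆ ((a , inj₁ a⊆P) ∷ is) u p with χ u a in eq
      ... | true  = a⊆P u eq
      ... | false = join⊆ is u (trans (sym (trans (χ-∨ u a (join is)) (cong (Bool._∨ χ u (join is)) eq))) p)

  -- The conditional space of a conditional algebra

  module Dual {ℓ} (A : ConditionalAlgebra ℓ) where
    open ConditionalAlgebra A using (booleanAlgebra; Carrier; _⇾_; ⇾-cong; ⇾-⊤; ⇾-∧; ∨-⇾)
    open BooleanAlgebraProperties booleanAlgebra using (∨-∧-orderTheoreticLattice)
    open Order.Lattice ∨-∧-orderTheoreticLattice
      using (_≤_; module Eq; x∧y≤x; x∧y≤y; y≤x∨y; ∨-least; reflexive; antisym)
      renaming (refl to ≤-refl; trans to ≤-trans)
    open Stone booleanAlgebra
    open TopologicalSpace topologicalSpace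
      using (ClosedSet; IsClosed; ⟨_⟩; ⟪_⟫; closed)

    -- Here `a ∨ a′` is `a′`, so `∨-⇾` applies to `a′ ⇾ b`.
    ⇾-antitoneˡ : ∀ {a a′} b → a ≤ a′ → a′ ⇾ b ≤ a ⇾ b
    ⇾-antitoneˡ {a} {a′} b a≤a′ =
      ≤-trans (reflexive (⇾-cong (antisym (y≤x∨y a a′) (∨-least a≤a′ ≤-refl)) Eq.refl))
        (≤-trans (∨-⇾ a a′ b) (x∧y≤x _ _))

    ⇾-monoʳ : ∀ a {b b′} → b ≤ b′ → a ⇾ b ≤ a ⇾ b′
    ⇾-monoʳ a {b} {b′} b≤b′ =
      ≤-trans (reflexive (Eq.trans (⇾-cong Eq.refl b≤b′) (Eq.sym (⇾-∧ a b b′)))) (x∧y≤y _ _)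

    -- The axioms `⇾-⊤` and `⇾-∧` are the filter conditions seen through `u`.
    section-isFilter : ∀ u a → IsFilter (λ b → χ u (a ⇾ b))
    section-isFilter u a = record
      { ⊤∈       = trans (χ-cong u (⇾-⊤ a)) (χ-⊤ u)
      ; ∧-closed = λ p q → trans (χ-cong u (Eq.sym (⇾-∧ a _ _))) (trans (χ-∧ u _ _) (∧-true p q))
      ; upward   = λ x≤y → χ-mono u (⇾-monoʳ a x≤y)
      }

    -- Only the basic clopens containing `Y` enter, which builds `T3` into the definition.
    T : Ultrafilter → ClosedSet → Pred Ultrafilter ℓ
    T u Y v = ∀ a b → ⟪ Y ⟫ ⊆ φ a → χ u (a ⇾ b) ≡ true → χ v b ≡ true

    -- If `c ⇾ d` is not in `u`, the filter of all `b` with `c ⇾ b` in `u` extends to some `v` in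
    -- `T u Y` omitting `d`. Working up to `≐` covers preimages of clopens.
    T⊆⇔⇾ : ∀ u Y (P : Pred Ultrafilter ℓ) {c d} → ⟪ Y ⟫ ≐ φ c → P ≐ φ d → T u Y ⊆ P ⇔ χ u (c ⇾ d) ≡ true
    T⊆⇔⇾ u Y P {c} {d} (Y⊆c , c⊆Y) (P⊆d , d⊆P) = mk⇔ to from
      where
      to : T u Y ⊆ P → χ u (c ⇾ d) ≡ true
      to T⊆P = Bool.¬-not λ c⇾d∉u →
        let v , section⊑v , d∉v = ultrafilter-theorem (section-isFilter u c) c⇾d∉u
            -- `separation` turns `φ c ⊆ Y ⊆ φ a` into `c ≤ a`, whence `a ⇾ b ≤ c ⇾ b`.
            v∈T : v ∈ T u Y
            v∈T = λ a b Y⊆a a⇾b∈u → section⊑v b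
              (χ-mono u (⇾-antitoneˡ b (separation λ w w∈c → lower (Y⊆a {w} (c⊆Y (lift w∈c))))) a⇾b∈u)
        in true≢false (lower (P⊆d {v} (T⊆P {v} v∈T))) d∉v

      from : χ u (c ⇾ d) ≡ true → T u Y ⊆ P
      from c⇾d∈u v∈T = d⊆P (lift (v∈T c d Y⊆c c⇾d∈u))

    T-closed : ∀ u Y → IsClosed (T u Y)
    T-closed u Y v v∉T with em {P = ∃[ a ] ∃[ b ] ⟪ Y ⟫ ⊆ φ a × χ u (a ⇾ b) ≡ true × χ v b ≢ true}
    ... | no none = ⊥-elim (v∉T λ a b Y⊆a p → dne λ q → none (a , b , Y⊆a , p , q))
    ... | yes (a , b , Y⊆a , a⇾b∈u , b∉v) = _ , χ-¬-false v (not-true⇒false b∉v) ,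
            λ w w∈-b w∈T → true≢false w∈-b (χ-¬-true w (w∈T a b Y⊆a a⇾b∈u))

    T⇒Tclopen : ∀ u Y v → v ∈ T u Y → ∀ C → ⟪ Y ⟫ ⊆ ⟨ C ⟩ → v ∈ T u (closed C)
    T⇒Tclopen u Y v v∈T C Y⊆C a b C⊆a = v∈T a b λ y∈Y → C⊆a (Y⊆C y∈Y)

    Tclopen⇒T : ∀ u Y v → (∀ C → ⟪ Y ⟫ ⊆ ⟨ C ⟩ → v ∈ T u (closed C)) → v ∈ T u Y
    Tclopen⇒T u Y v v∈T a b Y⊆a = v∈T (φ-clopen a) Y⊆a a b id

    conditionalSpace : ConditionalSpace ℓ
    conditionalSpace = record
      { booleanSpace = booleanSpace
      ; T            = T
      ; T1           = T-closed
      ; T2           = λ C D →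
          let c , C≐c = clopen-representation C
              d , D≐d = clopen-representation D
          in φ-clopen (c ⇾ d) ,
             (λ (lift c⇾d∈u) Z Z⊆C v∈T → proj₂ D≐d (lift
               (v∈T c d (λ z∈Z → proj₁ C≐c (Z⊆C z∈Z)) c⇾d∈u))) ,
             (λ {u} C⇾D → lift (Equivalence.to (T⊆⇔⇾ u (closed C) ⟨ D ⟩ C≐c D≐d) (C⇾D (closed C) id)))
      ; T3           = λ u Y v → mk⇔ (T⇒Tclopen u Y v) (Tclopen⇒T u Y v)
      }

  -- The conditional algebra of a conditional space

  module Clopens {ℓ} (X : BooleanSpace ℓ) where
    open BooleanSpace X

    -- The union is indexed by the points of `P`, which keeps the index type at level `ℓ`.
    open-local : ∀ {P} → (∀ x → x ∈ P → ∃[ Q ] IsOpen Q × x ∈ Q × Q ⊆ P) → IsOpen P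
    open-local {P} nbhd = open-resp
      ((λ {y} ((x , x∈P) , y∈Q) → proj₂ (proj₂ (proj₂ (nbhd x x∈P))) y∈Q) ,
       (λ {x} x∈P → (x , x∈P) , proj₁ (proj₂ (proj₂ (nbhd x x∈P)))))
      (open-⋃ (∃ P) (λ (x , x∈P) → proj₁ (nbhd x x∈P)) (λ (x , x∈P) → proj₁ (proj₂ (nbhd x x∈P))))

    -- Characteristic functions, because ClopenSet lives one universe too high
    -- to be the carrier of an algebra at level ℓ.
    record Clopen : Set ℓ where
      constructor clopen
      field
        mem     : Point → Bool
        isOpen  : IsOpen ⌈ mem ⌉
        isOpen¬ : IsOpen ⌈ not ∘′ mem ⌉

    open Clopen public using (mem)

    open-∨ : ∀ {f g : Point → Bool} → IsOpen ⌈ f ⌉ → IsOpen ⌈ g ⌉ → IsOpen ⌈ (λ x → f x Bool.∨ g x) ⌉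
    open-∨ {f} {g} f-open g-open = open-local λ x → nbhd x (f x) refl
      where
      nbhd : ∀ x b → f x ≡ b → Lift ℓ (f x Bool.∨ g x ≡ true) →
             ∃[ Q ] IsOpen Q × x ∈ Q × Q ⊆ ⌈ (λ x → f x Bool.∨ g x) ⌉
      nbhd x true  eq _        = _ , f-open , lift eq , λ (lift p) → lift (cong (Bool._∨ _) p)
      nbhd x false eq (lift p) = _ , g-open , lift (trans (sym (cong (Bool._∨ g x) eq)) p) ,
        λ {y} (lift q) → lift (trans (cong (f y Bool.∨_) q) (Bool.∨-zeroʳ (f y)))

    open-∧ : ∀ {f g : Point → Bool} → IsOpen ⌈ f ⌉ → IsOpen ⌈ g ⌉ → IsOpen ⌈ (λ x → f x Bool.∧ g x) ⌉
    open-∧ {f} {g} f-open g-open = open-resp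
      ((λ (lift p , lift q) → lift (∧-true p q)) ,
       (λ {x} (lift p) → lift (Bool.∧-conicalˡ _ _ p) , lift (Bool.∧-conicalʳ (f x) _ p)))
      (open-∩ f-open g-open)

    open-≗ : ∀ {f g : Point → Bool} → (∀ x → f x ≡ g x) → IsOpen ⌈ f ⌉ → IsOpen ⌈ g ⌉
    open-≗ f≗g = open-resp ((λ {x} (lift p) → lift (trans (sym (f≗g x)) p)) ,
                            (λ {x} (lift p) → lift (trans (f≗g x) p)))

    open-true : IsOpen ⌈ (λ (_ : Point) → true) ⌉
    open-true = open-resp ((λ _ → lift refl) , (λ _ → _)) open-U

    open-false : IsOpen ⌈ (λ (_ : Point) → false) ⌉
    open-false = open-resp ((λ ()) , (λ ())) open-∅

    toClopenSet : Clopen → ClopenSet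
    toClopenSet (clopen f o o¬) = clopenSet ⌈ f ⌉ o
      (open-resp ((λ (lift p) (lift q) → contradiction (cong not q) (true≢false p)) ,
                  (λ p → lift (cong not (not-true⇒false (p ∘′ lift))))) o¬)

    fromClopenSet : ClopenSet → Clopen
    fromClopenSet (clopenSet P o c) = clopen (λ x → ⌊ P x ⌋)
      (open-resp ((λ p → lift (⌊⌋⁺ p)) , (λ (lift p) → ⌊⌋⁻ p)) o)
      (open-resp ((λ p → lift (cong not (not-true⇒false (p ∘′ ⌊⌋⁻)))) ,
                  (λ (lift p) q → contradiction (cong not (⌊⌋⁺ q)) (true≢false p))) c)

    booleanAlgebra : BooleanAlgebra ℓ ℓ
    booleanAlgebra = record
      { Carrier = Clopen
      ; _≈_     = λ c d → ∀ x → mem c x ≡ mem d x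
      ; _∨_     = λ (clopen f fo f¬) (clopen g go g¬) → clopen (λ x → f x Bool.∨ g x) (open-∨ fo go)
          (open-≗ (λ x → sym (BoolProperties.deMorgan₂ (f x) (g x))) (open-∧ f¬ g¬))
      ; _∧_     = λ (clopen f fo f¬) (clopen g go g¬) → clopen (λ x → f x Bool.∧ g x) (open-∧ fo go)
          (open-≗ (λ x → sym (BoolProperties.deMorgan₁ (f x) (g x))) (open-∨ f¬ g¬))
      ; ¬_      = λ (clopen f fo f¬) → clopen (not ∘′ f) f¬
          (open-≗ (λ x → sym (Bool.not-involutive (f x))) fo)
      ; ⊤       = clopen (λ _ → true) open-true open-false
      ; ⊥       = clopen (λ _ → false) open-false open-true
      ; isBooleanAlgebra = record
        { isDistributiveLattice = record
          { isLattice = record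
            { isEquivalence = record
              { refl  = λ _ → refl
              ; sym   = λ p x → sym (p x)
              ; trans = λ p q x → trans (p x) (q x)
              }
            ; ∨-comm     = λ c d x → Bool.∨-comm (mem c x) (mem d x)
            ; ∨-assoc    = λ c d e x → Bool.∨-assoc (mem c x) (mem d x) (mem e x)
            ; ∨-cong     = λ p q x → cong₂ Bool._∨_ (p x) (q x)
            ; ∧-comm     = λ c d x → Bool.∧-comm (mem c x) (mem d x)
            ; ∧-assoc    = λ c d e x → Bool.∧-assoc (mem c x) (mem d x) (mem e x)
            ; ∧-cong     = λ p q x → cong₂ Bool._∧_ (p x) (q x)
            ; absorptive = (λ c d x → Bool.∨-abs-∧ (mem c x) (mem d x)) ,
                           (λ c d x → Bool.∧-abs-∨ (mem c x) (mem d x))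
            }
          ; ∨-distrib-∧ = (λ c d e x → Bool.∨-distribˡ-∧ (mem c x) (mem d x) (mem e x)) ,
                          (λ c d e x → Bool.∨-distribʳ-∧ (mem c x) (mem d x) (mem e x))
          ; ∧-distrib-∨ = (λ c d e x → Bool.∧-distribˡ-∨ (mem c x) (mem d x) (mem e x)) ,
                          (λ c d e x → Bool.∧-distribʳ-∨ (mem c x) (mem d x) (mem e x))
          }
        ; ∨-complement = (λ c x → Bool.∨-inverseˡ (mem c x)) , (λ c x → Bool.∨-inverseʳ (mem c x))
        ; ∧-complement = (λ c x → Bool.∧-inverseˡ (mem c x)) , (λ c x → Bool.∧-inverseʳ (mem c x))
        ; ¬-cong       = λ p x → cong not (p x)
        }
      }

  module Predual {ℓ} (X : ConditionalSpace ℓ) where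
    open ConditionalSpace X
    open Clopens booleanSpace

    -- By `T3` both sides are intersections over clopen supersets, and every clopen containing `Z`
    -- contains `Y`.
    T-mono : ∀ x Y Z → ⟪ Y ⟫ ⊆ ⟪ Z ⟫ → T x Y ⊆ T x Z
    T-mono x Y Z Y⊆Z {y} y∈T = Equivalence.from (T3 x Z y)
      λ C Z⊆C → Equivalence.to (T3 x Y y) y∈T C (λ p → Z⊆C (Y⊆Z p))

    _⇾_ : Clopen → Clopen → Clopen
    c ⇾ d = fromClopenSet (proj₁ (T2 (toClopenSet c) (toClopenSet d)))

    ∈⇾⁻ : ∀ c d x → mem (c ⇾ d) x ≡ true → T x (closed (toClopenSet c)) ⊆ ⌈ mem d ⌉
    ∈⇾⁻ c d x p = proj₁ (proj₂ (T2 C (toClopenSet d))) (⌊⌋⁻ p) (closed C) id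
      where C = toClopenSet c

    -- Monotonicity reduces the quantification over closed subsets of `C` in `T2` to the largest
    -- one, `C` itself.
    ∈⇾⁺ : ∀ c d x → T x (closed (toClopenSet c)) ⊆ ⌈ mem d ⌉ → mem (c ⇾ d) x ≡ true
    ∈⇾⁺ c d x T⊆ = ⌊⌋⁺ (proj₂ (proj₂ (T2 C (toClopenSet d)))
      λ Z Z⊆C y∈T → T⊆ (T-mono x Z (closed C) Z⊆C y∈T))
      where C = toClopenSet c

    ⇾-mono : ∀ {c c′ d d′} x → ⌈ mem c′ ⌉ ⊆ ⌈ mem c ⌉ → ⌈ mem d ⌉ ⊆ ⌈ mem d′ ⌉ →
             mem (c ⇾ d) x ≡ true → mem (c′ ⇾ d′) x ≡ true
    ⇾-mono {c} {c′} {d} {d′} x c′⊆c d⊆d′ p = ∈⇾⁺ c′ d′ x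
      λ y∈T → d⊆d′ (∈⇾⁻ c d x p
        (T-mono x (closed (toClopenSet c′)) (closed (toClopenSet c)) c′⊆c y∈T))

    ≈⇒⊆ : ∀ {c c′} → (∀ x → mem c x ≡ mem c′ x) → ⌈ mem c ⌉ ⊆ ⌈ mem c′ ⌉
    ≈⇒⊆ p {x} (lift q) = lift (trans (sym (p x)) q)

    open BooleanAlgebra booleanAlgebra using (_∧_; _∨_)

    conditionalAlgebra : ConditionalAlgebra ℓ
    conditionalAlgebra = record
      { booleanAlgebra = booleanAlgebra
      ; _⇾_    = _⇾_
      ; ⇾-cong = λ {c} {c′} {d} {d′} p q x → Bool.⇔→≡ (mk⇔
          (⇾-mono {c} {c′} {d} {d′} x (≈⇒⊆ {c′} {c} (λ y → sym (p y))) (≈⇒⊆ {d} {d′} q))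
          (⇾-mono {c′} {c} {d′} {d} x (≈⇒⊆ {c} {c′} p) (≈⇒⊆ {d′} {d} (λ y → sym (q y)))))
      ; ⇾-⊤    = λ c x → ∈⇾⁺ c _ x λ _ → lift refl
      ; ⇾-∧    = λ c d e x → Bool.⇔→≡ (mk⇔
          (λ p → ∈⇾⁺ c (d ∧ e) x λ y∈T → lift (∧-true
            (lower (∈⇾⁻ c d x (Bool.∧-conicalˡ _ _ p) y∈T))
            (lower (∈⇾⁻ c e x (Bool.∧-conicalʳ (mem (c ⇾ d) x) _ p) y∈T))))
          (λ p → ∧-true
            (⇾-mono {c} {c} {d ∧ e} {d} x id (λ (lift q) → lift (Bool.∧-conicalˡ _ _ q)) p)
            (⇾-mono {c} {c} {d ∧ e} {e} x id (λ {y} (lift q) → lift (Bool.∧-conicalʳ (mem d y) _ q)) p)))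
      ; ∨-⇾    = λ c d e x → Bool.⇔→≡ (mk⇔
          (λ p → ∧-true p (∧-true
            (⇾-mono {c ∨ d} {c} {e} {e} x (λ (lift q) → lift (cong (Bool._∨ _) q)) id p)
            (⇾-mono {c ∨ d} {d} {e} {e} x
              (λ {y} (lift q) → lift (trans (cong (mem c y Bool.∨_) q) (Bool.∨-zeroʳ (mem c y)))) id p)))
          (Bool.∧-conicalˡ _ _))
      }

    -- Preimages of clopens match `Bool`-valued clopens only up to `≐`; `T-mono`, used in both
    -- directions, carries `T` across.
    T⊆⇔∈⇾ : ∀ x Y (P : Pred Point ℓ) {c d} → ⟪ Y ⟫ ≐ ⌈ mem c ⌉ → P ≐ ⌈ mem d ⌉ →
            T x Y ⊆ P ⇔ mem (c ⇾ d) x ≡ true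
    T⊆⇔∈⇾ x Y P {c} {d} (Y⊆c , c⊆Y) (P⊆d , d⊆P) = mk⇔ to from
      where
      c̄ = closed (toClopenSet c)

      to : T x Y ⊆ P → mem (c ⇾ d) x ≡ true
      to T⊆P = ∈⇾⁺ c d x λ y∈T → P⊆d (T⊆P (T-mono x c̄ Y c⊆Y y∈T))

      from : mem (c ⇾ d) x ≡ true → T x Y ⊆ P
      from p y∈T = d⊆P (∈⇾⁻ c d x p (T-mono x Y c̄ Y⊆c y∈T))

  ≐-refl : {A : Set a} {P : Pred A ℓ} → P ≐ P
  ≐-refl = id , id

  ≡⇒⇔ : {x y : Bool} → x ≡ y → x ≡ true ⇔ y ≡ true
  ≡⇒⇔ refl = ⇔-id _

  -- The two contravariant functors

  module _ {ℓ : Level} where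
    open ConditionalHomomorphism
    open ConditionalFunction

    spectrumMap : {A B : ConditionalAlgebra ℓ} → ConditionalHomomorphism B A →
                  ConditionalFunction (Dual.conditionalSpace A) (Dual.conditionalSpace B)
    spectrumMap {A} {B} h = record
      { fun         = inverseImage
      ; continuous  = inverseImage-continuous
      ; conditional = inverseImage-conditional
      }
      where
      module A = Stone (ConditionalAlgebra.booleanAlgebra A)
      module B = Stone (ConditionalAlgebra.booleanAlgebra B)
      module A∗ = ConditionalSpace (Dual.conditionalSpace A)
      module B∗ = ConditionalSpace (Dual.conditionalSpace B)

      inverseImage : A.Ultrafilter → B.Ultrafilter
      inverseImage u = B.ultrafilter (λ b → A.χ u (⟦ h ⟧ b)) (record
        { χ-cong = λ p → A.χ-cong u (⟦⟧-cong h p)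
        ; χ-∧    = λ x y → trans (A.χ-cong u (∧-homo h x y)) (A.χ-∧ u _ _)
        ; χ-¬    = λ x → trans (A.χ-cong u (¬-homo h x)) (A.χ-¬ u _)
        })

      inverseImage-continuous : ∀ P → B∗.IsOpen P → A∗.IsOpen (inverseImage ⊢ P)
      inverseImage-continuous P o u u∈P =
        let b , u∈b , b⊆P = o (inverseImage u) u∈P in
        ⟦ h ⟧ b , u∈b , λ v → b⊆P (inverseImage v)

      inverseImage-φ : ∀ {P : Pred B.Ultrafilter ℓ} {b} → P ≐ B.φ b → inverseImage ⊢ P ≐ A.φ (⟦ h ⟧ b)
      inverseImage-φ (P⊆b , b⊆P) =
        (λ {u} p → lift (lower (P⊆b {inverseImage u} p))) ,
        (λ {u} p → b⊆P {inverseImage u} (lift (lower p)))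

      -- The closed set of `preimage C`, written out because `preimage` takes a finished conditional
      -- function.
      pullback : B∗.ClopenSet → A∗.ClosedSet
      pullback C = A∗.closedSet (inverseImage ⊢ B∗.⟨ C ⟩)
        (inverseImage-continuous (∁ B∗.⟨ C ⟩) (B∗.ClopenSet.isClosed C))

      inverseImage-conditional : ∀ u C D →
        A∗.T u (pullback C) ⊆ inverseImage ⊢ B∗.⟨ D ⟩ ⇔ B∗.T (inverseImage u) (B∗.closed C) ⊆ B∗.⟨ D ⟩
      inverseImage-conditional u C D =
        let c , C≐c = B.clopen-representation C
            d , D≐d = B.clopen-representation D
        -- The inclusions become membership of `⟦ h ⟧ c ⇾ ⟦ h ⟧ d` in `u` and of `c ⇾ d` in the
        -- inverse image of `u`; `⇾-homo` identifies them.
        in ⇔-sym (Dual.T⊆⇔⇾ B (inverseImage u) (B∗.closed C) B∗.⟨ D ⟩ C≐c D≐d)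
           ⇔-∘ (≡⇒⇔ (sym (A.χ-cong u (⇾-homo h c d)))
           ⇔-∘ Dual.T⊆⇔⇾ A u (pullback C) (inverseImage ⊢ B∗.⟨ D ⟩)
                 (inverseImage-φ C≐c) (inverseImage-φ D≐d))

    spectrum : Functor (op (CA ℓ)) (CS ℓ)
    spectrum = record
      { F₀     = Dual.conditionalSpace
      ; F₁     = spectrumMap
      ; F-cong = λ {A} {B} p u → Stone.ultrafilter-≡ (ConditionalAlgebra.booleanAlgebra B)
          λ b → Stone.χ-cong (ConditionalAlgebra.booleanAlgebra A) u (p b)
      -- Record eta and proof irrelevance make these equations definitional.
      ; F-id   = λ _ → refl
      ; F-∘    = λ _ _ _ → refl
      }

    clopensMap : {X Y : ConditionalSpace ℓ} → ConditionalFunction X Y →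
                 ConditionalHomomorphism (Predual.conditionalAlgebra Y) (Predual.conditionalAlgebra X)
    clopensMap {X} {Y} f = record
      { ⟦_⟧                   = inverseImage
      ; isLatticeHomomorphism = record
        { isRelHomomorphism = record { cong = λ p x → p (fun f x) }
        ; ∧-homo            = λ _ _ _ → refl
        ; ∨-homo            = λ _ _ _ → refl
        }
      ; ⊤-homo                = λ _ → refl
      ; ⊥-homo                = λ _ → refl
      ; ¬-homo                = λ _ _ → refl
      -- At `x` both memberships become inclusions of `T`-sets, which `conditional f` exchanges.
      ; ⇾-homo                = λ c d x → Bool.⇔→≡
          (Predual.T⊆⇔∈⇾ X x (X∗.closed (preimage f (Y.toClopenSet c))) X∗.⟨ preimage f (Y.toClopenSet d) ⟩
             {inverseImage c} {inverseImage d} ≐-refl ≐-refl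
           ⇔-∘ (⇔-sym (conditional f x (Y.toClopenSet c) (Y.toClopenSet d))
           ⇔-∘ ⇔-sym (Predual.T⊆⇔∈⇾ Y (fun f x) (Y∗.closed (Y.toClopenSet c)) Y∗.⟨ Y.toClopenSet d ⟩
             {c} {d} ≐-refl ≐-refl)))
      }
      where
      module X∗ = ConditionalSpace X
      module Y∗ = ConditionalSpace Y
      module X = Clopens X∗.booleanSpace
      module Y = Clopens Y∗.booleanSpace

      inverseImage : Y.Clopen → X.Clopen
      inverseImage (Y.clopen g o o¬) =
        X.clopen (λ x → g (fun f x)) (continuous f _ o) (continuous f _ o¬)

    clopens : Functor (CS ℓ) (op (CA ℓ))
    clopens = record
      { F₀     = Predual.conditionalAlgebra
      ; F₁     = clopensMap
      ; F-cong = λ p c x → cong (Clopens.mem c) (p x)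
      ; F-id   = λ _ _ → refl
      ; F-∘    = λ _ _ _ _ → refl
      }

  -- Every conditional algebra is the algebra of clopens of its spectrum

  module Representation {ℓ} (A : ConditionalAlgebra ℓ) where
    private
      module A = ConditionalAlgebra A
      A″ = Predual.conditionalAlgebra (Dual.conditionalSpace A)
      module A″ = ConditionalAlgebra A″
    open Stone A.booleanAlgebra
    open Clopens booleanSpace
    open BooleanSpace booleanSpace using (closed)

    φ̂ : A.Carrier → Clopen
    φ̂ a = clopen (λ u → χ u a) (φ-open a) (open-≗ (λ u → χ-¬ u a) (φ-open (A.¬ a)))

    -- Both sides describe the same inclusion of `T u (φ a)` in `φ b`, one through the algebra and
    -- one through the space.
    φ̂-⇾ : ∀ a b u → χ u (a A.⇾ b) ≡ mem (φ̂ a A″.⇾ φ̂ b) u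
    φ̂-⇾ a b u = Bool.⇔→≡
      (Predual.T⊆⇔∈⇾ (Dual.conditionalSpace A) u C D {φ̂ a} {φ̂ b} ≐-refl ≐-refl
       ⇔-∘ ⇔-sym (Dual.T⊆⇔⇾ A u C D ≐-refl ≐-refl))
      where
      C = closed (toClopenSet (φ̂ a))
      D = ⌈ mem (φ̂ b) ⌉

    φ-hom : ConditionalHomomorphism A A″
    φ-hom = record
      { ⟦_⟧                   = φ̂
      ; isLatticeHomomorphism = record
        { isRelHomomorphism = record { cong = λ p u → χ-cong u p }
        ; ∧-homo            = λ a b u → χ-∧ u a b
        ; ∨-homo            = λ a b u → χ-∨ u a b
        }
      ; ⊤-homo                = χ-⊤
      ; ⊥-homo                = χ-⊥
      ; ¬-homo                = λ a u → χ-¬ u a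
      ; ⇾-homo                = φ̂-⇾
      }

    φ⁻¹ : Clopen → A.Carrier
    φ⁻¹ c = proj₁ (clopen-representation (toClopenSet c))

    φ-φ⁻¹ : ∀ c u → χ u (φ⁻¹ c) ≡ mem c u
    φ-φ⁻¹ c u = let _ , c⊆ , ⊆c = clopen-representation (toClopenSet c) in
      Bool.⇔→≡ (mk⇔ (λ p → lower (⊆c (lift p))) (λ p → lower (c⊆ (lift p))))

    -- Elements are determined by the ultrafilters containing them, so each law is checked there,
    -- where `φ-φ⁻¹` reduces it to a law of `φ`.
    φ⁻¹-hom : ConditionalHomomorphism A″ A
    φ⁻¹-hom = record
      { ⟦_⟧                   = φ⁻¹
      ; isLatticeHomomorphism = record
        { isRelHomomorphism = record { cong = λ {c} {d} p → separation-≈ λ u →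
            trans (φ-φ⁻¹ c u) (trans (p u) (sym (φ-φ⁻¹ d u))) }
        ; ∧-homo            = λ c d → separation-≈ λ u → trans (φ-φ⁻¹ (c A″.∧ d) u)
            (sym (trans (χ-∧ u _ _) (cong₂ Bool._∧_ (φ-φ⁻¹ c u) (φ-φ⁻¹ d u))))
        ; ∨-homo            = λ c d → separation-≈ λ u → trans (φ-φ⁻¹ (c A″.∨ d) u)
            (sym (trans (χ-∨ u _ _) (cong₂ Bool._∨_ (φ-φ⁻¹ c u) (φ-φ⁻¹ d u))))
        }
      ; ⊤-homo                = separation-≈ λ u → trans (φ-φ⁻¹ A″.⊤ u) (sym (χ-⊤ u))
      ; ⊥-homo                = separation-≈ λ u → trans (φ-φ⁻¹ A″.⊥ u) (sym (χ-⊥ u))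
      ; ¬-homo                = λ c → separation-≈ λ u → trans (φ-φ⁻¹ (A″.¬ c) u)
          (sym (trans (χ-¬ u _) (cong not (φ-φ⁻¹ c u))))
      ; ⇾-homo                = λ c d → separation-≈ λ u → trans (φ-φ⁻¹ (c A″.⇾ d) u)
          (sym (trans (φ̂-⇾ (φ⁻¹ c) (φ⁻¹ d) u)
            (A″.⇾-cong {φ̂ (φ⁻¹ c)} {c} {φ̂ (φ⁻¹ d)} {d} (φ-φ⁻¹ c) (φ-φ⁻¹ d) u)))
      }

  -- Every conditional space is the spectrum of its algebra of clopens

  module Evaluation {ℓ} (X : ConditionalSpace ℓ) where
    private
      module X = ConditionalSpace X
      X∗ = Predual.conditionalAlgebra X
      module X∗ = ConditionalAlgebra X∗
      module X″ = ConditionalSpace (Dual.conditionalSpace X∗)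
    open Clopens X.booleanSpace using (Clopen; mem; toClopenSet; fromClopenSet; open-local)
    open Stone X∗.booleanAlgebra

    evaluate : X.Point → Ultrafilter
    evaluate x = ultrafilter (λ c → mem c x) (record
      { χ-cong = λ p → p x
      ; χ-∧    = λ _ _ → refl
      ; χ-¬    = λ _ → refl
      })

    -- A clopen neighbourhood of `x` inside `P` misses `y`, as `P` is disjoint from a neighbourhood
    -- of `y`.
    clopens-separate : ∀ {x y} → (∀ c → mem c x ≡ mem c y) → x ≡ y
    clopens-separate {x} {y} p = dne λ x≢y →
      let _ , _ , P-open , _ , x∈P , y∈Q , disjoint = X.hausdorff x≢y
          R , (R-open , R-closed) , x∈R , R⊆P        = X.zeroDimensional P-open x∈P
          y∈R = ⌊⌋⁻ (trans (sym (p (fromClopenSet (X.clopenSet R R-open R-closed)))) (⌊⌋⁺ x∈R))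
      in disjoint y (R⊆P y∈R , y∈Q)

    ⋀ : ∀ u → List (∃[ c ] χ u c ≡ true) → Clopen
    ⋀ u []             = X∗.⊤
    ⋀ u ((c , _) ∷ cs) = c X∗.∧ ⋀ u cs

    ⋀∈ : ∀ u cs → χ u (⋀ u cs) ≡ true
    ⋀∈ u []               = χ-⊤ u
    ⋀∈ u ((c , c∈u) ∷ cs) = trans (χ-∧ u c (⋀ u cs)) (∧-true c∈u (⋀∈ u cs))

    ⋀-lower : ∀ u cs {x} → Any (λ (c , _) → mem c x ≢ true) cs → mem (⋀ u cs) x ≡ false
    ⋀-lower u ((c , _) ∷ cs) {x} (here x∉c) =
      cong (Bool._∧ mem (⋀ u cs) x) (not-true⇒false x∉c)
    ⋀-lower u ((c , _) ∷ cs) {x} (there p)  =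
      trans (cong (mem c x Bool.∧_) (⋀-lower u cs p)) (Bool.∧-zeroʳ (mem c x))

    -- Otherwise the complements of the members of `u` cover the space, and a finite subcover yields
    -- members of `u` whose meet is `⊥`.
    converges : ∀ u → ∃[ x ] ∀ c → χ u c ≡ true → mem c x ≡ true
    converges u = dne λ none →
      let cs , covers = X.compact (∃[ c ] χ u c ≡ true)
            (λ (c , _) → ∁ ⌈ mem c ⌉)
            (λ (c , _) → X.ClopenSet.isClosed (toClopenSet c))
            (λ x → dne λ p → none (x , λ c c∈u → dne λ x∉c → p ((c , c∈u) , x∉c ∘′ lower)))
          ⋀≈⊥ = λ x → ⋀-lower u cs (Any.map (λ x∉c → x∉c ∘′ lift) (covers x))
      in true≢false (⋀∈ u cs) (trans (χ-cong u {⋀ u cs} {X∗.⊥} ⋀≈⊥) (χ-⊥ u))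

    limitPoint : Ultrafilter → X.Point
    limitPoint u = proj₁ (converges u)

    -- If `c` is not in `u`, its complement is, and convergence places the limit in that complement.
    χ-limit : ∀ u c → χ u c ≡ mem c (limitPoint u)
    χ-limit u c with χ u c in eq
    ... | true  = sym (proj₂ (converges u) c eq)
    ... | false = sym (trans (sym (Bool.not-involutive _))
                    (cong not (proj₂ (converges u) (X∗.¬ c) (χ-¬-false u eq))))

    limit-unique : ∀ u {x} → (∀ c → χ u c ≡ mem c x) → limitPoint u ≡ x
    limit-unique u p = clopens-separate λ c → trans (sym (χ-limit u c)) (p c)

    evaluation-continuous : ∀ P → X″.IsOpen P → X.IsOpen (evaluate ⊢ P)
    evaluation-continuous P o = open-local λ x x∈P →
      let c , x∈c , c⊆P = o (evaluate x) x∈P in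
      ⌈ mem c ⌉ , Clopen.isOpen c , lift x∈c , λ {y} (lift y∈c) → c⊆P (evaluate y) y∈c

    evaluation-φ : ∀ {P : Pred Ultrafilter ℓ} {c} → P ≐ φ c → evaluate ⊢ P ≐ ⌈ mem c ⌉
    evaluation-φ (P⊆c , c⊆P) =
      (λ {x} p → lift (lower (P⊆c {evaluate x} p))) ,
      (λ {x} p → c⊆P {evaluate x} (lift (lower p)))

    evaluate⁻¹ : X″.ClopenSet → X.ClosedSet
    evaluate⁻¹ C = X.closedSet (evaluate ⊢ X″.⟨ C ⟩)
      (evaluation-continuous (∁ X″.⟨ C ⟩) (X″.ClopenSet.isClosed C))

    evaluation-conditional : ∀ x C D →
      X.T x (evaluate⁻¹ C) ⊆ evaluate ⊢ X″.⟨ D ⟩ ⇔ X″.T (evaluate x) (X″.closed C) ⊆ X″.⟨ D ⟩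
    evaluation-conditional x C D =
      let c , C≐c = clopen-representation C
          d , D≐d = clopen-representation D
      -- `χ (evaluate x) (c ⇾ d)` is by definition `mem (c ⇾ d) x`, so the two equivalences compose
      -- directly.
      in ⇔-sym (Dual.T⊆⇔⇾ X∗ (evaluate x) (X″.closed C) X″.⟨ D ⟩ C≐c D≐d)
         ⇔-∘ Predual.T⊆⇔∈⇾ X x (evaluate⁻¹ C) (evaluate ⊢ X″.⟨ D ⟩) {c} {d}
               (evaluation-φ C≐c) (evaluation-φ D≐d)

    evaluation : ConditionalFunction X (Dual.conditionalSpace X∗)
    evaluation = record
      { fun         = evaluate
      ; continuous  = evaluation-continuous
      ; conditional = evaluation-conditional
      }

    limit-φ : ∀ C → limitPoint ⊢ X.⟨ C ⟩ ≐ φ (fromClopenSet C)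
    limit-φ C =
      (λ {u} p → lift (trans (χ-limit u (fromClopenSet C)) (⌊⌋⁺ p))) ,
      (λ {u} (lift p) → ⌊⌋⁻ (trans (sym (χ-limit u (fromClopenSet C))) p))

    -- Clopens form a basis of `X`, and `limit-φ` makes their preimages basic open sets of the
    -- spectrum.
    limit-continuous : ∀ P → X.IsOpen P → X″.IsOpen (limitPoint ⊢ P)
    limit-continuous P o u u∈P =
      let R , (R-open , R-closed) , u∈R , R⊆P = X.zeroDimensional o u∈P
          C = X.clopenSet R R-open R-closed
      in fromClopenSet C , lower (proj₁ (limit-φ C) {u} u∈R) ,
         λ v v∈ → R⊆P (proj₂ (limit-φ C) {v} (lift v∈))

    limitPoint⁻¹ : X.ClopenSet → X″.ClosedSet
    limitPoint⁻¹ C = X″.closedSet (limitPoint ⊢ X.⟨ C ⟩)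
      (limit-continuous (∁ X.⟨ C ⟩) (X.ClopenSet.isClosed C))

    limit-conditional : ∀ u C D →
      X″.T u (limitPoint⁻¹ C) ⊆ limitPoint ⊢ X.⟨ D ⟩ ⇔ X.T (limitPoint u) (X.closed C) ⊆ X.⟨ D ⟩
    limit-conditional u C D =
      ⇔-sym (Predual.T⊆⇔∈⇾ X (limitPoint u) (X.closed C) X.⟨ D ⟩ {c} {d}
        ((λ p → lift (⌊⌋⁺ p)) , (λ p → ⌊⌋⁻ (lower p)))
        ((λ p → lift (⌊⌋⁺ p)) , (λ p → ⌊⌋⁻ (lower p))))
      ⇔-∘ (≡⇒⇔ (χ-limit u (c X∗.⇾ d))
      ⇔-∘ Dual.T⊆⇔⇾ X∗ u (limitPoint⁻¹ C) (limitPoint ⊢ X.⟨ D ⟩) (limit-φ C) (limit-φ D))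
      where
      c = fromClopenSet C
      d = fromClopenSet D

    limitFunction : ConditionalFunction (Dual.conditionalSpace X∗) X
    limitFunction = record
      { fun         = limitPoint
      ; continuous  = limit-continuous
      ; conditional = limit-conditional
      }

  -- The unit and counit of the dual equivalence.

  module _ {ℓ : Level} where
    open Representation
    open Evaluation
    open ConditionalFunction using (fun)
    open ConditionalHomomorphism using (⟦_⟧)

    unit : NaturalIsomorphism idF (clopens {ℓ} ∘F spectrum)
    unit = record
      -- The unit lives in the opposite category, so its component at `A` is a homomorphism into
      -- `A`.
      { η        = φ⁻¹-hom
      ; η⁻¹      = φ-hom
      -- At each `u`, both sides evaluate `c` at the inverse image of `u` under `f`.
      ; natural  = λ {A} {B} f c → Stone.separation-≈ (ConditionalAlgebra.booleanAlgebra A) λ u →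
          trans (φ-φ⁻¹ B c (fun (spectrumMap f) u))
            (sym (φ-φ⁻¹ A (⟦ clopensMap (spectrumMap f) ⟧ c) u))
      ; inverseˡ = λ A a → Stone.separation-≈ (ConditionalAlgebra.booleanAlgebra A) (φ-φ⁻¹ A (φ̂ A a))
      ; inverseʳ = φ-φ⁻¹
      }

    counit : NaturalIsomorphism (spectrum {ℓ} ∘F clopens) idF
    counit = record
      { η        = limitFunction
      ; η⁻¹      = evaluation
      -- A limit is determined by the clopens containing it, and `c` contains the image under `f` of
      -- the limit of `u` exactly when the preimage of `c` is in `u`.
      ; natural  = λ {X} {Y} f u → limit-unique Y (fun (spectrumMap (clopensMap f)) u) λ c →
          χ-limit X u (⟦ clopensMap f ⟧ c)
      ; inverseˡ = λ X u → Stone.ultrafilter-≡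
          (ConditionalAlgebra.booleanAlgebra (Predual.conditionalAlgebra X)) λ c → sym (χ-limit X u c)
      ; inverseʳ = λ X x → limit-unique X (evaluate X x) λ _ → refl
      }

theorem6p5 : (∀ {a} → ExcludedMiddle a) →
    (∀ {a b} → Extensionality a b) →
    ∀ ℓ → DuallyEquivalent (CA ℓ) (CS ℓ)
theorem6p5 em ext ℓ = record { F = spectrum; G = clopens; unit = unit; counit = counit }
  where open Classical em ext
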